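{- Let a $\Lambda$-structure over $T$ be given such that some (unary) $\heartsuit\in\Lambda$ is $\omega$-bounded without being $k$-bounded for any $k\in\omega$. Suppose that either $\Sigma$ contains a predicate symbol of positive arity or $\Lambda$ contains a propositional atom. Then strong completeness fails for this structure; that is, for no set $\mathcal R$ of one-step sound one-step rules and no boundedness signature $\flat$ is $\vdash^{\mathcal{HR}}_\flat$ strongly complete for the structure, where strong completeness means: for every set $\Gamma\subseteq\mathrm{CPL}(\Lambda,\Sigma)$ of sentences, $\Gamma\not\vdash^{\mathcal{HR}}_\flat\bot$ if and only if there is a coalgebraic model (over the given structure) for $\Gamma$.
   Context: **Syntax.** $\Lambda$ is a set of modal operators (unary, apart from nullary propositional atoms) and $\Sigma$ a set of predicate symbols with finite arities; $\mathsf{iVar}$ is a fixed supply of individual variables. Formulas of $\mathrm{CPL}(\Lambda,\Sigma)$: $\phi::= y_1=y_2\mid P(\vec x)\mid\bot\mid\phi\to\psi\mid\forall x.\phi\mid x\heartsuit\lceil y_1:\phi_1\rceil\dots\lceil y_n:\phi_n\rceil$ with $P\in\Sigma$ and $\heartsuit\in\Lambda$ $n$-ary (so $x\heartsuit\lceil y:\phi\rceil$ for $n=1$, and $x\,p$ for a nullary $p$). In the last clause $x$ is free and $y_i$ is bound in $\phi_i$. Other connectives and $\exists$ are defined as usual. A sentence is a formula without free variables; a variable is fresh for a formula if it is not free in it, and fresh for a variable if distinct from it. $\phi[t/x]$ is substitution of the variable $t$ for the free occurrences of $x$, written only if $t$ is substitutable for $x$ in $\phi$ (no capture by $\forall$ or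 by a comprehension $\lceil y:\cdot\rceil$). **Semantics.** A $\Lambda$-structure is a functor $T:\mathsf{Set}\to\mathsf{Set}$ with, for each $n$-ary $\heartsuit\in\Lambda$, maps $\llbracket\heartsuit\rrbracket_C:\mathcal P(C)^n\to\mathcal P(TC)$ for all sets $C$, natural: $(Tf)^{ -1}[\llbracket\heartsuit\rrbracket_D(B_1,\dots,B_n)]=\llbracket\heartsuit\rrbracket_C(f^{ -1}[B_1],\dots,f^{ -1}[B_n])$ for $f:C\to D$. A coalgebraic model is $\mathfrak M=(C,\gamma,I)$ with $\gamma:C\to TC$ and $I$ interpreting each $k$-ary $P\in\Sigma$ as a subset of $C^k$. For $v:\mathsf{iVar}\to C$, satisfaction is standard for first-order constructs, and $\mathfrak M,v\models x\heartsuit\lceil y_1:\phi_1\rceil\dots\lceil y_n:\phi_n\rceil$ iff $\gamma(v(x))\in\llbracket\heartsuit\rrbracket_C(A_1,\dots,A_n)$, where $A_i=\{c\in C\mid\mathfrak M,v[y_i\mapsto c]\models\phi_i\}$. $\mathfrak M$ is a model for a set $\Gamma$ of sentences if $\mathfrak M,v\models\gamma$ for all $\gamma\in\Gamma$, for some valuation $v$ (the choice of $v$ being immaterial for sentences). **Boundedness and atoms.** A unary $\heartsuit$ is $k$-bounded ($k\in\omega$) if $\llbracket\heartsuit\rrbracket_C(A)=\bigcup_{B\subseteq A,\ \#B\le k}\llbracket\heartsuit\rrbracket_C(B)$ for all sets $C$ and $A\subseteq C$; it is $\omega$-bounded if $\llbracket\heartsuit\rrbracket_C(A)=\bigcup_{B\subseteq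 A,\ B\text{ finite}}\llbracket\heartsuit\rrbracket_C(B)$ for all $C$ and $A\subseteq C$. A nullary modality $p\in\Lambda$ is a propositional atom if $T$ decomposes as $T=T'\times 2$ with $2=\{\bot,\top\}$ and, under this decomposition, $\llbracket p\rrbracket_X=T'X\times\{\top\}$ for all $X$. A boundedness signature $\flat$ assigns to each $n$-ary $\heartsuit\in\Lambda$ a vector $\flat(\heartsuit)\in(\mathbb N\cup\{\infty\})^n$. **One-step rules.** $\mathsf{sVar}$ is a fixed collection of schematic variables. A one-step rule $A/X$ has $A$ a Boolean formula over $\mathsf{sVar}$ and $X$ a finite disjunction of formulas $\heartsuit p_1\dots p_n$ ($\heartsuit\in\Lambda$ $n$-ary, $p_i\in\mathsf{sVar}$) and negations of such, each schematic variable occurring at most once in $X$ and every variable of $A$ occurring in $X$. For $\tau:\mathsf{sVar}\to\mathcal P(C)$, $A$ is evaluated in $\mathcal P(C)$ by Boolean operations, and $X$ in $\mathcal P(TC)$ by evaluating $\heartsuit p_1\dots p_n$ as $\llbracket\heartsuit\rrbracket_C(\tau(p_1),\dots,\tau(p_n))$ and using Boolean operations; the rule is one-step sound if, for all $C$ and $\tau$, $X$ evaluates to $TC$ whenever $A$ evaluates to $C$. **The relation $\vdash^{\mathcal{HR}}_{\flat}$.** $\Gamma\vdash^{\mathcal{HR}}_\flat\phi$ iff there are $\gamma_1,\dots,\gamma_n\in\Gamma$ such that $\gamma_1\to\dots\to\gamma_n\to\phi$ is derivable by Modus Ponens only from the following axioms, where $\forall\vec y$ is any (possibly empty) string of universal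 quantifiers: - $\forall\vec y.\phi$, for $\phi$ a propositional tautology; - $\forall\vec y.((\forall x.\phi)\to\phi[z/x])$; - $\forall\vec y.(\forall x.(\phi\to\psi)\to((\forall x.\phi)\to\forall x.\psi))$; - $\forall\vec y.(\phi\to\forall x.\phi)$, $x$ fresh for $\phi$; - $\forall\vec y.(x=x)$; - $\forall\vec y.(x=z\to P(\vec u,x,\vec w)\to P(\vec u,z,\vec w))$ for $P\in\Sigma\cup\{=\}$; - $\forall\vec y.(x=z\to x\heartsuit\lceil y_1:\phi_1\rceil\dots\lceil y_n:\phi_n\rceil\to z\heartsuit\lceil y_1:\phi_1\rceil\dots\lceil y_n:\phi_n\rceil)$; - (Alpha) $\forall\vec y.((x\heartsuit\dots\lceil z:\phi\rceil\dots)\to(x\heartsuit\dots\lceil u:\phi[u/z]\rceil\dots))$, $u$ fresh for $\phi$; - (Onestep) $\forall\vec y.\forall z.((\forall x.A\sigma)\to[\sigma,x,z]X)$ for $A/X\in\mathcal R$ and $\sigma:\mathsf{sVar}\to\mathrm{CPL}(\Lambda,\Sigma)$, where $[\sigma,x,z]X$ results from $X$ by replacing each $\heartsuit p_1\dots p_n$ with $z\heartsuit\lceil x:\sigma(p_1)\rceil\dots\lceil x:\sigma(p_n)\rceil$; - (BdPL) whenever $k=\flat(\heartsuit)(i)\ne\infty$, with $z_1,\dots,z_k$ fresh for $y_i$ and for all $\phi_j$: $\forall\vec y.(x\heartsuit\dots\lceil y_i:\phi_i\rceil\dots\leftrightarrow\exists z_1\dots z_k.(\bigwedge_{j\le k}\phi_i[z_j/y_i]\wedge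 x\heartsuit\dots\lceil y_i:\bigvee_{j\le k}y_i=z_j\rceil\dots))$. -}

module Defs where

open import Data.Bool.Base using (Bool; true; false; if_then_else_; not; _∨_)
open import Data.Empty using (⊥)
open import Data.Fin.Base using (Fin; zero; suc)
open import Data.List.Base as List using (List; []; _∷_; _++_; length; concatMap)
import Data.List.Membership.Propositional as List∈
open import Data.List.Relation.Binary.Subset.Propositional using () renaming (_⊆_ to _⊆ˡ_)
open import Data.List.Relation.Unary.All using (All)
open import Data.List.Relation.Unary.Unique.Propositional using (Unique)
open import Data.Nat.Base using (ℕ; suc; _≤_)
open import Data.Nat.Properties using (_≟_)
open import Data.Product.Base using (_×_; _,_; proj₁; proj₂; ∃-syntax; map₁)
open import Data.Sum.Base using (_⊎_)
open import Data.Unit.Base using (⊤)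
open import Data.Vec.Base as Vec using (Vec; []; _∷_; lookup; toList; _[_]≔_)
import Data.Vec.Membership.Propositional as Vec∈
open import Function.Base using (_∘_; id)
open import Function.Bundles using (_⇔_; _↔_; Inverse)
open import Level using (0ℓ)
open import Relation.Binary.PropositionalEquality using (_≡_; _≢_)
open import Relation.Nullary using (¬_; does)
open import Relation.Nullary.Construct.Add.Supremum using (_⁺; [_])
open import Relation.Unary using (Pred; _∈_; _∉_; _⊆_; _≐_; _∪_; ∅; ∁; Universal; _⊢_)
  renaming (_⇒_ to _⇒ᵖ_)

-- Signatures are families indexed by arity: Λ n is the set of n-ary modal
-- operators, and Σ n is the set of n-ary predicate symbols.
private
  variable
    Λ Σ : ℕ → Set
    n   : ℕ

iVar sVar : Set
iVar = ℕ
sVar = ℕ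

infix  9 _≈_
infixr 5 _⊃_
infixr 7 _∧ᶠ_
infixr 6 _∨ᶠ_
infix  4 _⇔ᶠ_
infix  8 ¬ᶠ_

-- modal x ♡ ((y₁ , φ₁) ∷ … ∷ (yₙ , φₙ) ∷ []) is x ♡ ⌈y₁:φ₁⌉ … ⌈yₙ:φₙ⌉.
data Formula (Λ Σ : ℕ → Set) : Set where
  _≈_   : iVar → iVar → Formula Λ Σ
  rel   : Σ n → Vec iVar n → Formula Λ Σ
  ⊥ᶠ    : Formula Λ Σ
  _⊃_   : Formula Λ Σ → Formula Λ Σ → Formula Λ Σ
  all   : iVar → Formula Λ Σ → Formula Λ Σ
  modal : iVar → Λ n → Vec (iVar × Formula Λ Σ) n → Formula Λ Σ

¬ᶠ_ : Formula Λ Σ → Formula Λ Σ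
¬ᶠ φ = φ ⊃ ⊥ᶠ

⊤ᶠ : Formula Λ Σ
⊤ᶠ = ¬ᶠ ⊥ᶠ

_∧ᶠ_ _∨ᶠ_ _⇔ᶠ_ : Formula Λ Σ → Formula Λ Σ → Formula Λ Σ
φ ∧ᶠ ψ = ¬ᶠ (φ ⊃ ¬ᶠ ψ)
φ ∨ᶠ ψ = ¬ᶠ φ ⊃ ψ
φ ⇔ᶠ ψ = (φ ⊃ ψ) ∧ᶠ (ψ ⊃ φ)

ex : iVar → Formula Λ Σ → Formula Λ Σ
ex x φ = ¬ᶠ (all x (¬ᶠ φ))

alls exs : List iVar → Formula Λ Σ → Formula Λ Σ
alls ys φ = List.foldr all φ ys
exs  ys φ = List.foldr ex φ ys

⋀ ⋁ : List (Formula Λ Σ) → Formula Λ Σ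
⋀ []           = ⊤ᶠ
⋀ (φ ∷ [])     = φ
⋀ (φ ∷ ψ ∷ φs) = φ ∧ᶠ ⋀ (ψ ∷ φs)
⋁ []           = ⊥ᶠ
⋁ (φ ∷ [])     = φ
⋁ (φ ∷ ψ ∷ φs) = φ ∨ᶠ ⋁ (ψ ∷ φs)

infix 4 _∈FV_ _∈FVs_

mutual
  _∈FV_ : iVar → Formula Λ Σ → Set
  x ∈FV (y ≈ z)         = x ≡ y ⊎ x ≡ z
  x ∈FV rel P ys        = x Vec∈.∈ ys
  x ∈FV ⊥ᶠ              = ⊥
  x ∈FV (φ ⊃ ψ)         = x ∈FV φ ⊎ x ∈FV ψ
  x ∈FV all y φ         = x ≢ y × x ∈FV φ
  x ∈FV modal y ♡ args  = x ≡ y ⊎ x ∈FVs args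

  _∈FVs_ : iVar → Vec (iVar × Formula Λ Σ) n → Set
  x ∈FVs []               = ⊥
  x ∈FVs ((y , φ) ∷ args) = (x ≢ y × x ∈FV φ) ⊎ x ∈FVs args

FreshFor : iVar → Formula Λ Σ → Set
FreshFor x φ = ¬ (x ∈FV φ)

Sentence : Formula Λ Σ → Set
Sentence φ = ∀ x → FreshFor x φ

infix 20 _[_/_]

rename : iVar → iVar → iVar → iVar
rename t x y = if does (y ≟ x) then t else y

mutual
  _[_/_] : Formula Λ Σ → iVar → iVar → Formula Λ Σ
  (y ≈ z)        [ t / x ] = rename t x y ≈ rename t x z
  rel P ys       [ t / x ] = rel P (Vec.map (rename t x) ys)
  ⊥ᶠ             [ t / x ] = ⊥ᶠ
  (φ ⊃ ψ)        [ t / x ] = φ [ t / x ] ⊃ ψ [ t / x ]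
  all y φ        [ t / x ] = all y (if does (y ≟ x) then φ else φ [ t / x ])
  modal y ♡ args [ t / x ] = modal (rename t x y) ♡ (substArgs t x args)

  substArgs : iVar → iVar → Vec (iVar × Formula Λ Σ) n → Vec (iVar × Formula Λ Σ) n
  substArgs t x []               = []
  substArgs t x ((y , φ) ∷ args) =
    (y , (if does (y ≟ x) then φ else φ [ t / x ])) ∷ substArgs t x args

mutual
  Substitutable : iVar → iVar → Formula Λ Σ → Set
  Substitutable t x (φ ⊃ ψ)          = Substitutable t x φ × Substitutable t x ψ
  Substitutable t x (all y φ)        = SubstitutableUnder t x y φ
  Substitutable t x (modal y ♡ args) = SubstitutableArgs t x args
  Substitutable t x (_ ≈ _)          = ⊤
  Substitutable t x (rel _ _)        = ⊤
  Substitutable t x ⊥ᶠ               = ⊤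

  SubstitutableArgs : iVar → iVar → Vec (iVar × Formula Λ Σ) n → Set
  SubstitutableArgs t x []               = ⊤
  SubstitutableArgs t x ((y , φ) ∷ args) =
    SubstitutableUnder t x y φ × SubstitutableArgs t x args

  SubstitutableUnder : iVar → iVar → iVar → Formula Λ Σ → Set
  SubstitutableUnder t x y φ =
    ¬ (x ≢ y × x ∈FV φ) ⊎ (y ≢ t × Substitutable t x φ)

-- Functions of sets are extensional, which is what map-cong records; the
-- functor laws are stated pointwise for the same reason.
record SetFunctor : Set₁ where
  field
    F₀       : Set → Set
    F₁       : ∀ {C D} → (C → D) → F₀ C → F₀ D
    map-cong : ∀ {C D} {f g : C → D} → (∀ c → f c ≡ g c) → ∀ t → F₁ f t ≡ F₁ g t
    map-id   : ∀ {C} (t : F₀ C) → F₁ id t ≡ t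
    map-∘    : ∀ {C D E} (g : D → E) (f : C → D) t → F₁ (g ∘ f) t ≡ F₁ g (F₁ f t)

-- Subsets of C are predicates on C, compared by mutual inclusion _≐_; ⟦⟧-cong
-- says that ⟦ ♡ ⟧ depends only on the subsets, not on the predicates.
record Structure (Λ : ℕ → Set) : Set₁ where
  field
    functor : SetFunctor
  open SetFunctor functor public renaming (F₀ to T; F₁ to Tmap)
  field
    ⟦_⟧        : Λ n → ∀ {C : Set} → (Fin n → Pred C 0ℓ) → Pred (T C) 0ℓ
    ⟦⟧-cong    : (♡ : Λ n) → ∀ {C} {A B : Fin n → Pred C 0ℓ} →
                 (∀ i → A i ≐ B i) → ⟦ ♡ ⟧ A ≐ ⟦ ♡ ⟧ B
    ⟦⟧-natural : (♡ : Λ n) → ∀ {C D} (f : C → D) (B : Fin n → Pred D 0ℓ) →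
                 (Tmap f ⊢ ⟦ ♡ ⟧ B) ≐ ⟦ ♡ ⟧ (λ i → f ⊢ B i)

record Model (S : Structure Λ) (Σ : ℕ → Set) : Set₁ where
  open Structure S
  field
    C : Set
    γ : C → T C
    I : Σ n → Pred (Vec C n) 0ℓ

_[_↦_] : {C : Set} → (iVar → C) → iVar → C → iVar → C
(v [ x ↦ c ]) y = if does (y ≟ x) then c else v y

module Satisfaction {Λ Σ : ℕ → Set} {S : Structure Λ} (M : Model S Σ) where
  open Structure S
  open Model M

  infix 4 _⊨_

  -- Classical satisfaction, and Boolean operations on predicates below, are
  -- obtained by using these definitions under excluded middle for Set.
  mutual
    _⊨_ : (iVar → C) → Formula Λ Σ → Set
    v ⊨ (y ≈ z)        = v y ≡ v z
    v ⊨ rel P ys       = I P (Vec.map v ys)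
    v ⊨ ⊥ᶠ             = ⊥
    v ⊨ (φ ⊃ ψ)        = v ⊨ φ → v ⊨ ψ
    v ⊨ all x φ        = ∀ c → v [ x ↦ c ] ⊨ φ
    v ⊨ modal x ♡ args = γ (v x) ∈ ⟦ ♡ ⟧ (extensions v args)

    extensions : (iVar → C) → Vec (iVar × Formula Λ Σ) n → Fin n → Pred C 0ℓ
    extensions v ((y , φ) ∷ args) zero    c = v [ y ↦ c ] ⊨ φ
    extensions v (_       ∷ args) (suc i) c = extensions v args i c

HasModel : Structure Λ → Pred (Formula Λ Σ) 0ℓ → Set₁
HasModel {Σ = Σ} S Γ =
  ∃[ M ] let open Satisfaction {Σ = Σ} {S = S} M in
    ∃[ v ] (∀ {φ} → φ ∈ Γ → v ⊨ φ)

Card≤ : {C : Set} → ℕ → Pred C 0ℓ → Set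
Card≤ k B = ∃[ xs ] (length xs ≤ k × B ≐ (List∈._∈ xs))

Finite : {C : Set} → Pred C 0ℓ → Set
Finite B = ∃[ xs ] B ≐ (List∈._∈ xs)

-- For unary ♡, the one-element family λ _ → A is the argument tuple (A).
Bounded : (S : Structure Λ) → ℕ → Λ 1 → Set₁
Bounded S k ♡ = ∀ {C : Set} (A : Pred C 0ℓ) →
  ⟦ ♡ ⟧ (λ _ → A) ≐ (λ t → ∃[ B ] (B ⊆ A × Card≤ k B × t ∈ ⟦ ♡ ⟧ (λ _ → B)))
  where open Structure S

ωBounded : (S : Structure Λ) → Λ 1 → Set₁
ωBounded S ♡ = ∀ {C : Set} (A : Pred C 0ℓ) →
  ⟦ ♡ ⟧ (λ _ → A) ≐ (λ t → ∃[ B ] (B ⊆ A × Finite B × t ∈ ⟦ ♡ ⟧ (λ _ → B)))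
  where open Structure S

-- T = T' × 2 as functors, i.e. up to natural isomorphism, with true as ⊤.
record PropositionalAtom (S : Structure Λ) (p : Λ 0) : Set₁ where
  open Structure S
  field
    functor' : SetFunctor
  open SetFunctor functor' using () renaming (F₀ to T'; F₁ to T'map)
  field
    split         : ∀ X → T X ↔ (T' X × Bool)
    split-natural : ∀ {X Y} (f : X → Y) (t : T X) →
      Inverse.to (split Y) (Tmap f t) ≡ map₁ (T'map f) (Inverse.to (split X) t)
    ⟦p⟧           : ∀ X (none : Fin 0 → Pred X 0ℓ) →
      ⟦ p ⟧ none ≐ (λ t → proj₂ (Inverse.to (split X) t) ≡ true)

-- ℕ ⁺ is ℕ ∪ {∞}, with [ k ] the finite value k.
BoundednessSignature : (ℕ → Set) → Set
BoundednessSignature Λ = ∀ {n} → Λ n → Vec (ℕ ⁺) n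

data BoolFormula : Set where
  svar : sVar → BoolFormula
  ⊥ᵇ   : BoolFormula
  _⊃ᵇ_ : BoolFormula → BoolFormula → BoolFormula

data Literal (Λ : ℕ → Set) : Set where
  pos neg : Λ n → Vec sVar n → Literal Λ

varsᵇ : BoolFormula → List sVar
varsᵇ (svar p) = p ∷ []
varsᵇ ⊥ᵇ       = []
varsᵇ (A ⊃ᵇ B) = varsᵇ A ++ varsᵇ B

varsˡ : Literal Λ → List sVar
varsˡ (pos ♡ ps) = toList ps
varsˡ (neg ♡ ps) = toList ps

-- The conclusion is the disjunction of the listed literals.
record Rule (Λ : ℕ → Set) : Set where
  field
    premise    : BoolFormula
    conclusion : List (Literal Λ)
    linear     : Unique (concatMap varsˡ conclusion)
    covered    : varsᵇ premise ⊆ˡ concatMap varsˡ conclusion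

module _ {C : Set} (τ : sVar → Pred C 0ℓ) where
  evalᵇ : BoolFormula → Pred C 0ℓ
  evalᵇ (svar p) = τ p
  evalᵇ ⊥ᵇ       = ∅
  evalᵇ (A ⊃ᵇ B) = evalᵇ A ⇒ᵖ evalᵇ B

  module _ (S : Structure Λ) where
    open Structure S

    evalˡ : Literal Λ → Pred (T C) 0ℓ
    evalˡ (pos ♡ ps) = ⟦ ♡ ⟧ (λ i → τ (lookup ps i))
    evalˡ (neg ♡ ps) = ∁ (⟦ ♡ ⟧ (λ i → τ (lookup ps i)))

    evalᶜ : List (Literal Λ) → Pred (T C) 0ℓ
    evalᶜ = List.foldr (λ l X → evalˡ l ∪ X) ∅

OneStepSound : Structure Λ → Rule Λ → Set₁
OneStepSound S r = ∀ {C : Set} (τ : sVar → Pred C 0ℓ) →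
  Universal (evalᵇ τ premise) → Universal (evalᶜ τ S conclusion)
  where open Rule r

module _ (σ : sVar → Formula Λ Σ) where
  substᵇ : BoolFormula → Formula Λ Σ
  substᵇ (svar p) = σ p
  substᵇ ⊥ᵇ       = ⊥ᶠ
  substᵇ (A ⊃ᵇ B) = substᵇ A ⊃ substᵇ B

  substˡ : iVar → iVar → Literal Λ → Formula Λ Σ
  substˡ x z (pos ♡ ps) = modal z ♡ (Vec.map (λ p → x , σ p) ps)
  substˡ x z (neg ♡ ps) = ¬ᶠ (modal z ♡ (Vec.map (λ p → x , σ p) ps))

  substᶜ : iVar → iVar → List (Literal Λ) → Formula Λ Σ
  substᶜ x z ls = ⋁ (List.map (substˡ x z) ls)

-- Every formula not of the form ⊥ᶠ or φ ⊃ ψ counts as a propositional atom.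
truth : (Formula Λ Σ → Bool) → Formula Λ Σ → Bool
truth h ⊥ᶠ      = false
truth h (φ ⊃ ψ) = not (truth h φ) ∨ truth h ψ
truth h φ       = h φ

Tautology : Formula Λ Σ → Set
Tautology φ = ∀ h → truth h φ ≡ true

-- In bdpl, the variables zs are pairwise distinct and distinct from x: otherwise
-- the quantifiers ∃z₁…zₖ would collapse or capture x, and the axiom would be
-- unsound even for modalities that are k-bounded in the i-th argument.
data Axiom {Λ Σ : ℕ → Set} (R : Pred (Rule Λ) 0ℓ) (♭ : BoundednessSignature Λ) :
           Pred (Formula Λ Σ) 0ℓ where
  taut     : ∀ {φ} → Tautology φ → Axiom R ♭ φ
  inst     : ∀ x z φ → Substitutable z x φ → Axiom R ♭ (all x φ ⊃ φ [ z / x ])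
  all-⊃    : ∀ x φ ψ → Axiom R ♭ (all x (φ ⊃ ψ) ⊃ all x φ ⊃ all x ψ)
  vacuous  : ∀ x φ → FreshFor x φ → Axiom R ♭ (φ ⊃ all x φ)
  ≈-refl   : ∀ x → Axiom R ♭ (x ≈ x)
  ≈-congˡ  : ∀ x z w → Axiom R ♭ (x ≈ z ⊃ x ≈ w ⊃ z ≈ w)
  ≈-congʳ  : ∀ x z u → Axiom R ♭ (x ≈ z ⊃ u ≈ x ⊃ u ≈ z)
  rel-cong : ∀ x z (P : Σ n) us i →
             Axiom R ♭ (x ≈ z ⊃ rel P (us [ i ]≔ x) ⊃ rel P (us [ i ]≔ z))
  mod-cong : ∀ x z (♡ : Λ n) args →
             Axiom R ♭ (x ≈ z ⊃ modal x ♡ args ⊃ modal z ♡ args)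
  alpha    : ∀ x u (♡ : Λ n) (args : Vec (iVar × Formula Λ Σ) n) i → let (z , φ) = lookup args i in
             FreshFor u φ → Substitutable u z φ →
             Axiom R ♭ (modal x ♡ args ⊃ modal x ♡ (args [ i ]≔ (u , φ [ u / z ])))
  onestep  : ∀ {r} → r ∈ R → ∀ (σ : sVar → Formula Λ Σ) x z → let open Rule r in
             Axiom R ♭ (all z (all x (substᵇ σ premise) ⊃ substᶜ σ x z conclusion))
  bdpl     : ∀ x (♡ : Λ n) (args : Vec (iVar × Formula Λ Σ) n) i {k} →
             lookup (♭ ♡) i ≡ [ k ] →
             let (y , φ) = lookup args i in
             (zs : Vec iVar k) → Unique (toList zs) →
             All (λ z → z ≢ x × z ≢ y ×
                        (∀ j → FreshFor z (proj₂ (lookup args j))) ×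
                        Substitutable z y φ) (toList zs) →
             Axiom R ♭
               (modal x ♡ args ⇔ᶠ
                exs (toList zs)
                  (⋀ (List.map (λ z → φ [ z / y ]) (toList zs)) ∧ᶠ
                   modal x ♡ (args [ i ]≔ (y , ⋁ (List.map (y ≈_) (toList zs))))))

data Theorem {Λ Σ : ℕ → Set} (R : Pred (Rule Λ) 0ℓ) (♭ : BoundednessSignature Λ) :
             Pred (Formula Λ Σ) 0ℓ where
  axiom : ∀ ys {φ} → Axiom R ♭ φ → Theorem R ♭ (alls ys φ)
  mp    : ∀ {φ ψ} → Theorem R ♭ (φ ⊃ ψ) → Theorem R ♭ φ → Theorem R ♭ ψ

Derives : Pred (Rule Λ) 0ℓ → BoundednessSignature Λ →
          Pred (Formula Λ Σ) 0ℓ → Formula Λ Σ → Set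
Derives R ♭ Γ φ = ∃[ γs ] (All (_∈ Γ) γs × Theorem R ♭ (List.foldr _⊃_ φ γs))

StronglyComplete : Structure Λ → (Σ : ℕ → Set) →
                   Pred (Rule Λ) 0ℓ → BoundednessSignature Λ → Set₁
StronglyComplete {Λ} S Σ R ♭ = ∀ (Γ : Pred (Formula Λ Σ) 0ℓ) →
  (∀ {φ} → φ ∈ Γ → Sentence φ) → (¬ Derives R ♭ Γ ⊥ᶠ) ⇔ HasModel S Γ

{-# OPTIONS --safe #-}
-- An ω-bounded ♡ that is not k-bounded for any k violates compactness.  Let α
-- define an arbitrary subset (a predicate symbol or a propositional atom).  The
-- set consisting of "some x with g(x) satisfies x♡⌈y:α(y)⌉" and, for every k,
-- "for no x with g(x) do k elements of α suffice for ♡" is unsatisfiable by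
-- ω-boundedness, but its finite parts are satisfied by coalgebras built from a
-- failure (C, A, t) of k-boundedness: all points that satisfy the guard g have
-- t as successor structure, and α is interpreted as A.  A propositional atom
-- fixes part of γ, so that γ cannot be constantly t; then g picks the points
-- whose atom agrees with that of t.  Soundness need not be proved: it is one
-- direction of the equivalence to be refuted.
-- Excluded middle is available only for Set, so the existence of failures of
-- k-boundedness, a statement in Set₁, appears doubly negated.
module Submission where

open import Defs
open import Axiom.ExcludedMiddle using (ExcludedMiddle)
open import Data.Bool.Base using (Bool; true; false)
open import Data.Empty using (⊥; ⊥-elim)
open import Data.Fin.Base using (zero)
open import Data.List.Base as List using (List; []; _∷_; length; foldr; reverse; _ʳ++_)
open import Data.List.Membership.Propositional using () renaming (_∈_ to _∈ˡ_)
open import Data.List.Membership.Propositional.Properties using (∈-map⁺; ∈-map⁻)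
open import Data.List.Properties using (length-map; length-reverse; map-cong-local)
open import Data.List.Relation.Unary.All as All using (All; []; _∷_)
open import Data.List.Relation.Unary.Any using (here; there)
open import Data.List.Relation.Unary.Any.Properties using (reverse⁺; reverse⁻)
open import Data.Maybe.Base using (Maybe; just; nothing)
open import Data.Maybe.Relation.Unary.Any using (just) renaming (Any to AnyMaybe)
open import Data.Nat.Base using (ℕ; zero; suc; _+_; _≤_; _<_; z≤n; _⊔_)
open import Data.Nat.Properties
  using (_≟_; ≤-refl; ≤-reflexive; ≤-trans; <⇒≤; >⇒≢; m≤m⊔n; m≤n⊔m)
open import Data.Product.Base using (_×_; _,_; proj₁; proj₂; ∃-syntax)
open import Data.Sum.Base using (_⊎_; inj₁; inj₂; [_,_]′)
open import Data.Vec.Base as Vec using ([]; _∷_; replicate)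
open import Data.Vec.Properties using (map-replicate)
open import Data.Vec.Relation.Unary.Any using (here; there)
import Data.Vec.Membership.Propositional as Vec∈
open import Function.Base using (id; _∘_; const)
open import Function.Bundles using (_⇔_; mk⇔; Equivalence; Inverse)
open import Level using (0ℓ)
open import Relation.Binary.PropositionalEquality
  using (_≡_; _≢_; refl; sym; trans; cong; cong₂; subst)
open import Relation.Nullary using (¬_; Dec; yes; no; does)
open import Relation.Nullary.Decidable using (dec-true; dec-false)
open import Relation.Unary using (Pred; _∈_; _∉_; _≐_)

open Equivalence using (to; from)

private
  variable
    Λ Σ : ℕ → Set

-- Updated valuations.

update-same : ∀ {C : Set} (v : iVar → C) x c → (v [ x ↦ c ]) x ≡ c
update-same v x c rewrite dec-true (x ≟ x) refl = refl

update-other : ∀ {C : Set} (v : iVar → C) x c {y} → y ≢ x → (v [ x ↦ c ]) y ≡ v y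
update-other v x c {y} y≢x rewrite dec-false (y ≟ x) y≢x = refl

map-update : ∀ {C : Set} (v : iVar → C) x c {zs} → All (_≢ x) zs →
             List.map (v [ x ↦ c ]) zs ≡ List.map v zs
map-update v x c zs≢x = map-cong-local (All.map (update-other v x c) zs≢x)

-- Compactness as a consequence of strong completeness.

compactness : ∀ (S : Structure Λ) {R} {♭ : BoundednessSignature Λ} → StronglyComplete S Σ R ♭ →
  (Φ : ℕ → Formula Λ Σ) → (∀ k → Sentence (Φ k)) →
  (∀ K → ¬ ¬ HasModel S (λ φ → ∃[ k ] (k ≤ K × φ ≡ Φ k))) →
  HasModel S (λ φ → ∃[ k ] φ ≡ Φ k)
compactness {Λ} {Σ} S {R} {♭} complete Φ sentence finitely =
  to (complete Γ λ { (k , refl) → sentence k }) consistent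
  where
  Γ : Pred (Formula _ _) 0ℓ
  Γ φ = ∃[ k ] φ ≡ Φ k

  Γ≤ : ℕ → Pred (Formula _ _) 0ℓ
  Γ≤ K φ = ∃[ k ] (k ≤ K × φ ≡ Φ k)

  bound : ∀ {φs} → All (_∈ Γ) φs → ∃[ K ] All (_∈ Γ≤ K) φs
  bound []               = 0 , []
  bound ((k , eq) ∷ φs∈) with K , φs∈≤ ← bound φs∈ =
    k ⊔ K , (k , m≤m⊔n k K , eq) ∷
            All.map (λ { (j , j≤K , eq′) → j , ≤-trans j≤K (m≤n⊔m k K) , eq′ }) φs∈≤

  -- A derivation uses finitely many premises, all in one initial segment, and a model of that
  -- segment makes it consistent by the soundness half of `complete`. Consistency is a negation, so
  -- doubly negated models suffice.
  consistent : ¬ Derives R ♭ Γ ⊥ᶠ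
  consistent (φs , φs∈ , d) with K , φs∈≤ ← bound φs∈ =
    finitely K λ M →
      from (complete (Γ≤ K) λ { (k , _ , refl) → sentence k }) M (φs , φs∈≤ , d)

-- Formulas in one variable that define subsets of models.

record UnaryFormula (S : Structure Λ) (Σ : ℕ → Set) : Set₁ where
  field
    -- A function of the variable, so that instances at different variables arise without
    -- substitution.
    at  : iVar → Formula Λ Σ
    fv  : ∀ {x} y → x ∈FV at y → x ≡ y
    ⟪_⟫ : (M : Model S Σ) → Pred (Model.C M) 0ℓ
    sat : ∀ M v y → Satisfaction._⊨_ M v (at y) ⇔ v y ∈ ⟪ M ⟫

module _ (S : Structure Λ) where
  open Structure S

  ⊤ᵘ : UnaryFormula S Σ
  ⊤ᵘ = record
    { at  = λ _ → ⊤ᶠ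
    ; fv  = λ { _ (inj₁ ()) ; _ (inj₂ ()) }
    ; ⟪_⟫ = λ M c → Satisfaction._⊨_ M (const c) ⊤ᶠ
    ; sat = λ _ _ _ → mk⇔ id id
    }

  ¬ᵘ_ : UnaryFormula S Σ → UnaryFormula S Σ
  ¬ᵘ α = record
    { at  = λ y → ¬ᶠ at y
    ; fv  = λ { y (inj₁ x∈) → fv y x∈ }
    ; ⟪_⟫ = λ M c → ¬ (c ∈ ⟪ M ⟫)
    ; sat = λ M v y → mk⇔ (_∘ from (sat M v y)) (_∘ to (sat M v y))
    }
    where open UnaryFormula α

  -- Identifying all arguments turns a symbol of any positive arity into a unary one.
  diagonal : ∀ {n} → Σ (suc n) → UnaryFormula S Σ
  diagonal {n = n} P = record
    { at  = λ y → rel P (replicate (suc n) y)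
    ; fv  = λ y → ∈-replicate (suc n)
    ; ⟪_⟫ = λ M c → Model.I M P (replicate (suc n) c)
    ; sat = λ M v y → let eq = map-replicate v y (suc n) in
              mk⇔ (subst (Model.I M P) eq) (subst (Model.I M P) (sym eq))
    }
    where
    ∈-replicate : ∀ m {x y : iVar} → x Vec∈.∈ replicate m y → x ≡ y
    ∈-replicate (suc m) (here eq)  = eq
    ∈-replicate (suc m) (there x∈) = ∈-replicate m x∈

  atomic : Λ 0 → UnaryFormula S Σ
  atomic p = record
    { at  = λ y → modal y p []
    ; fv  = λ { y (inj₁ eq) → eq }
    ; ⟪_⟫ = λ M c → Model.γ M c ∈ ⟦ p ⟧ (λ ())
    -- Both argument families are indexed by the empty type, but only `⟦⟧-cong` identifies them.
    ; sat = λ M v y → mk⇔ (proj₁ (⟦⟧-cong p λ ())) (proj₂ (⟦⟧-cong p λ ()))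
    }

  -- The data for a model of `Φ 0`, ..., `Φ K` below. `point` witnesses `Φ 0`; the other sentences
  -- quantify universally over guarded points, hence so does `unsupported`.
  record Separates (♡ : Λ 1) (g α : UnaryFormula S Σ) (K : ℕ) : Set₁ where
    private
      module g = UnaryFormula g
      module α = UnaryFormula α
    field
      model : Model S Σ
    open Model model
    field
      point       : C
      guarded     : point ∈ g.⟪ model ⟫
      supported   : γ point ∈ ⟦ ♡ ⟧ (λ _ → α.⟪ model ⟫)
      unsupported : ∀ {c} → c ∈ g.⟪ model ⟫ → ∀ xs → length xs ≤ K →
                    All (_∈ α.⟪ model ⟫) xs → γ c ∉ ⟦ ♡ ⟧ (λ _ → _∈ˡ xs)

-- The finitely satisfiable, unsatisfiable set of sentences.

module Incompactness (em : ExcludedMiddle 0ℓ) (S : Structure Λ) (♡ : Λ 1)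
                     (ω-bounded : ωBounded S ♡) (g α : UnaryFormula S Σ) where
  open Structure S
  private
    module g = UnaryFormula g
    module α = UnaryFormula α

  -- Unlike `⋁`, this fold has no separate singleton case, which keeps the inductions uniform.
  oneOf : iVar → List iVar → Formula Λ Σ
  oneOf y = foldr (λ z φ → y ≈ z ∨ᶠ φ) ⊥ᶠ

  -- The variables are 0 for x, 1 for y, and 2 + j for z_j.
  noSupport : ℕ → List iVar → Formula Λ Σ
  noSupport zero    zs = ¬ᶠ modal 0 ♡ ((1 , oneOf 1 zs) ∷ [])
  noSupport (suc k) zs = all (2 + k) (α.at (2 + k) ⊃ noSupport k (2 + k ∷ zs))

  -- Index 0 is taken by the existential sentence, so the sentence about k elements has index
  -- `suc k`.
  Φ : ℕ → Formula Λ Σ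
  Φ zero    = ¬ᶠ all 0 (g.at 0 ⊃ ¬ᶠ modal 0 ♡ ((1 , α.at 1) ∷ []))
  Φ (suc k) = all 0 (g.at 0 ⊃ noSupport k [])

  oneOf-fv : ∀ {x} y zs → x ∈FV oneOf y zs → x ≡ y ⊎ x ∈ˡ zs
  oneOf-fv y (z ∷ zs) (inj₁ (inj₁ (inj₁ eq))) = inj₁ eq
  oneOf-fv y (z ∷ zs) (inj₁ (inj₁ (inj₂ eq))) = inj₂ (here eq)
  oneOf-fv y (z ∷ zs) (inj₂ x∈) = [ inj₁ , inj₂ ∘ there ]′ (oneOf-fv y zs x∈)

  noSupport-fv : ∀ {x} k zs → x ∈FV noSupport k zs → x ≡ 0 ⊎ x ∈ˡ zs
  noSupport-fv zero    zs (inj₁ (inj₁ eq)) = inj₁ eq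
  noSupport-fv zero    zs (inj₁ (inj₂ (inj₁ (x≢1 , x∈)))) =
    [ ⊥-elim ∘ x≢1 , inj₂ ]′ (oneOf-fv 1 zs x∈)
  noSupport-fv (suc k) zs (x≢ , inj₁ x∈) = ⊥-elim (x≢ (α.fv _ x∈))
  noSupport-fv (suc k) zs (x≢ , inj₂ x∈) with noSupport-fv k _ x∈
  ... | inj₁ eq         = inj₁ eq
  ... | inj₂ (here eq)  = ⊥-elim (x≢ eq)
  ... | inj₂ (there x∈) = inj₂ x∈

  Φ-sentence : ∀ k → Sentence (Φ k)
  Φ-sentence zero x (inj₁ (x≢0 , inj₁ x∈)) = x≢0 (g.fv 0 x∈)
  Φ-sentence zero x (inj₁ (x≢0 , inj₂ (inj₁ (inj₁ eq)))) = x≢0 eq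
  Φ-sentence zero x (inj₁ (x≢0 , inj₂ (inj₁ (inj₂ (inj₁ (x≢1 , x∈)))))) = x≢1 (α.fv 1 x∈)
  Φ-sentence (suc k) x (x≢0 , inj₁ x∈) = x≢0 (g.fv 0 x∈)
  Φ-sentence (suc k) x (x≢0 , inj₂ x∈) with noSupport-fv k [] x∈
  ... | inj₁ eq = x≢0 eq

  module _ (M : Model S Σ) where
    open Model M
    open Satisfaction M

    private
      A : Pred C 0ℓ
      A = α.⟪ M ⟫

    oneOf-sat : ∀ v y zs → v ⊨ oneOf y zs ⇔ v y ∈ˡ List.map v zs
    oneOf-sat v y []       = mk⇔ (λ ()) (λ ())
    oneOf-sat v y (z ∷ zs) = mk⇔ ⇒ ⇐
      where
      ⇒ : v ⊨ oneOf y (z ∷ zs) → v y ∈ˡ List.map v (z ∷ zs)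
      -- Disjunction is coded as an implication from a negation, so extracting a disjunct takes
      -- excluded middle.
      ⇒ s with em {P = v y ≡ v z}
      ... | yes eq = here eq
      ... | no  ≢  = there (to (oneOf-sat v y zs) (s ≢))

      ⇐ : v y ∈ˡ List.map v (z ∷ zs) → v ⊨ oneOf y (z ∷ zs)
      ⇐ (here eq)  ≢ = ⊥-elim (≢ eq)
      ⇐ (there y∈) _ = from (oneOf-sat v y zs) y∈

    -- The bound on `zs` keeps the comprehension variable 1 apart from the witnesses, whose values
    -- thus survive its update.
    support-sat : ∀ v {zs} → All (1 <_) zs →
      v ⊨ modal 0 ♡ ((1 , oneOf 1 zs) ∷ []) ⇔ γ (v 0) ∈ ⟦ ♡ ⟧ (λ _ → _∈ˡ List.map v zs)
    support-sat v {zs} 1<zs = mk⇔ (proj₁ (⟦⟧-cong ♡ same)) (proj₂ (⟦⟧-cong ♡ same))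
      where
      same : ∀ i → extensions v ((1 , oneOf 1 zs) ∷ []) i ≐ (_∈ˡ List.map v zs)
      same zero =
        (λ {c} s → subst (c ∈ˡ_) (eq c) (to (oneOf-sat (v [ 1 ↦ c ]) 1 zs) s)) ,
        (λ {c} c∈ → from (oneOf-sat (v [ 1 ↦ c ]) 1 zs) (subst (c ∈ˡ_) (sym (eq c)) c∈))
        where
        eq : ∀ c → List.map (v [ 1 ↦ c ]) zs ≡ List.map v zs
        eq c = map-update v 1 c (All.map >⇒≢ 1<zs)

    -- Induction on k, with the values of `zs` as the witnesses chosen so far. Each quantifier puts
    -- its witness in front, so `xs` enters in reverse order, as `ʳ++` computes. The bound on `zs`
    -- separates it from the variables 2, ..., `suc k` still to be quantified.
    noSupport-sat : ∀ k v {zs} → All (suc k <_) zs →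
      v ⊨ noSupport k zs ⇔
      (∀ xs → length xs ≡ k → All (_∈ A) xs →
       γ (v 0) ∉ ⟦ ♡ ⟧ (λ _ → _∈ˡ (xs ʳ++ List.map v zs)))
    noSupport-sat zero v 1<zs = mk⇔
      (λ { s [] _ _ → s ∘ from (support-sat v 1<zs) })
      (λ h → h [] refl [] ∘ to (support-sat v 1<zs))
    noSupport-sat (suc k) v {zs} k<zs = mk⇔
      (λ { s (c ∷ xs) refl (c∈ ∷ xs∈) →
           subst (Avoids xs) (eq c)
             (to (IH c) (s c (from (α-sat c) c∈)) xs refl xs∈) })
      (λ h c c∈ → from (IH c) λ xs len xs∈ →
           subst (Avoids xs) (sym (eq c)) (h (c ∷ xs) (cong suc len) (to (α-sat c) c∈ ∷ xs∈)))
      where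
      z = 2 + k

      Avoids : List C → Pred (List C) 0ℓ
      Avoids xs ys = γ (v 0) ∉ ⟦ ♡ ⟧ (λ _ → _∈ˡ (xs ʳ++ ys))

      IH = λ c → noSupport-sat k (v [ z ↦ c ]) {z ∷ zs} (≤-refl ∷ All.map <⇒≤ k<zs)

      eq : ∀ c → List.map (v [ z ↦ c ]) (z ∷ zs) ≡ c ∷ List.map v zs
      eq c = cong₂ _∷_ (update-same v z c) (map-update v z c (All.map >⇒≢ k<zs))

      α-sat : ∀ c → v [ z ↦ c ] ⊨ α.at z ⇔ c ∈ A
      α-sat c = subst (λ d → v [ z ↦ c ] ⊨ α.at z ⇔ d ∈ A) (update-same v z c) (α.sat M _ z)

    Φ₀-sat : ∀ {v c} → v [ 0 ↦ c ] ⊨ modal 0 ♡ ((1 , α.at 1) ∷ []) ⇔ γ c ∈ ⟦ ♡ ⟧ (λ _ → A)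
    Φ₀-sat {v} {c} = mk⇔ (proj₁ (⟦⟧-cong ♡ same)) (proj₂ (⟦⟧-cong ♡ same))
      where
      same : ∀ i → extensions (v [ 0 ↦ c ]) ((1 , α.at 1) ∷ []) i ≐ A
      same zero = to (α.sat M _ 1) , from (α.sat M _ 1)

  Φ-satisfiable : ∀ {K} → Separates S ♡ g α K → HasModel S (λ φ → ∃[ k ] (k ≤ K × φ ≡ Φ k))
  Φ-satisfiable {K} sep = model , v , λ { (k , k≤K , refl) → models k k≤K }
    where
    open Separates sep
    open Satisfaction model
    v = const point

    models : ∀ k → k ≤ K → v ⊨ Φ k
    models zero    _   s =
      s point (from (g.sat model _ 0) guarded) (from (Φ₀-sat model {v}) supported)
    -- With no witnesses chosen beforehand, `xs ʳ++ []` is `reverse xs`.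
    models (suc k) k<K c gc = from (noSupport-sat model k _ []) λ xs len xs∈ t∈ →
      unsupported (to (g.sat model _ 0) gc) (reverse xs)
        (≤-trans (≤-reflexive (trans (length-reverse xs) len)) (<⇒≤ k<K))
        (All.tabulate (λ x∈ → All.lookup xs∈ (reverse⁻ x∈)))
        t∈

  Φ-unsatisfiable : ¬ HasModel S (λ φ → ∃[ k ] φ ≡ Φ k)
  Φ-unsatisfiable (M , v , models) = models (0 , refl) λ c gc s →
    let B , B⊆A , (xs , B≐xs) , t∈ = proj₁ (ω-bounded _) (to (Φ₀-sat M {v}) s) in
    -- The length of a list of the finite support `B` selects the sentence that is violated.
    to (noSupport-sat M (length xs) _ []) (models (suc (length xs) , refl) c gc)
      xs refl
      (All.tabulate (B⊆A ∘ proj₂ B≐xs))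
      (proj₁ (⟦⟧-cong ♡ λ _ → reverse⁺ ∘ proj₁ B≐xs , proj₂ B≐xs ∘ reverse⁻) t∈)

  incompact : ∀ {R} {♭ : BoundednessSignature Λ} → (∀ K → ¬ ¬ Separates S ♡ g α K) →
              ¬ StronglyComplete S Σ R ♭
  incompact separates complete = Φ-unsatisfiable
    (compactness S complete Φ Φ-sentence λ K ¬M → separates K (¬M ∘ Φ-satisfiable))

-- Failures of k-boundedness.

record BoundFailure (S : Structure Λ) (♡ : Λ 1) (k : ℕ) : Set₁ where
  open Structure S
  field
    C           : Set
    A           : Pred C 0ℓ
    t           : T C
    supported   : t ∈ ⟦ ♡ ⟧ (λ _ → A)
    unsupported : ∀ xs → length xs ≤ k → All (_∈ A) xs → t ∉ ⟦ ♡ ⟧ (λ _ → _∈ˡ xs)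
    -- If the atom is false at `t`, the guard will select exactly the points outside `A`, and one
    -- must exist.
    outside     : ∃[ c ] c ∉ A

module _ (em : ExcludedMiddle 0ℓ) (S : Structure Λ) (♡ : Λ 1) where
  open Structure S

  -- An empty `A` would be the set listed by `[]`, which `unsupported` excludes.
  inside : ∀ {k} (F : BoundFailure S ♡ k) → let open BoundFailure F in ∃[ c ] c ∈ A
  inside F with em {P = ∃[ c ] c ∈ BoundFailure.A F}
  ... | yes c∈A  = c∈A
  ... | no empty = ⊥-elim (unsupported [] z≤n []
      (proj₁ (⟦⟧-cong ♡ λ _ → (λ c∈A → ⊥-elim (empty (_ , c∈A))) , λ ()) supported))
    where open BoundFailure F

  -- A fresh point is added to C: by naturality this changes nothing for ♡.
  addPoint : ∀ {k C A} (t : T C) → t ∈ ⟦ ♡ ⟧ (λ _ → A) →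
    (∀ xs → length xs ≤ k → All (_∈ A) xs → t ∉ ⟦ ♡ ⟧ (λ _ → _∈ˡ xs)) →
    BoundFailure S ♡ k
  addPoint {k} {C} {A} t supp unsupp = record
    { C           = Maybe C
    ; A           = AnyMaybe A
    ; t           = Tmap just t
    ; supported   = proj₂ (⟦⟧-natural ♡ just _)
                      (proj₁ (⟦⟧-cong ♡ λ _ → just , λ { (just c∈) → c∈ }) supp)
    ; unsupported = unsupp′
    ; outside     = nothing , λ ()
    }
    where
    fromJusts : ∀ {ys} → All (AnyMaybe A) ys → ∃[ xs ] (All (_∈ A) xs × List.map just xs ≡ ys)
    fromJusts []             = [] , [] , refl
    fromJusts (just c∈ ∷ ys) with xs , xs∈ , refl ← fromJusts ys = _ ∷ xs , c∈ ∷ xs∈ , refl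

    unsupp′ : ∀ ys → length ys ≤ k → All (AnyMaybe A) ys →
              Tmap just t ∉ ⟦ ♡ ⟧ (λ _ → _∈ˡ ys)
    unsupp′ ys len ys∈ t∈ with xs , xs∈ , refl ← fromJusts ys∈ =
      unsupp xs (subst (_≤ k) (length-map just xs) len) xs∈
        (proj₁ (⟦⟧-cong ♡ λ _ → unjust , ∈-map⁺ just) (proj₁ (⟦⟧-natural ♡ just _) t∈))
      where
      unjust : ∀ {c} → just c ∈ˡ List.map just xs → c ∈ˡ xs
      unjust c∈ with _ , x∈ , refl ← ∈-map⁻ just c∈ = x∈

  boundFailure : ωBounded S ♡ → ∀ k → ¬ Bounded S k ♡ → ¬ ¬ BoundFailure S ♡ k
  boundFailure ω-bounded k unbounded ¬failure = unbounded bounded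
    where
    bounded : Bounded S k ♡
    -- Sets of at most k elements are finite, so ω-boundedness yields the inclusion from right to
    -- left.
    bounded {C} A = finiteSubset , λ { (B , B⊆A , (xs , _ , B≐xs) , t∈) →
        proj₂ (ω-bounded A) (B , B⊆A , (xs , B≐xs) , t∈) }
      where
      finiteSubset : ∀ {t} → t ∈ ⟦ ♡ ⟧ (λ _ → A) →
        ∃[ B ] ((∀ {c} → B c → A c) × Card≤ k B × t ∈ ⟦ ♡ ⟧ (λ _ → B))
      finiteSubset {t} t∈
        -- For fixed `C`, `A` and `t` the existence of a small support lies in `Set`, and can be
        -- decided.
        with em {P = ∃[ xs ] (length xs ≤ k × All (_∈ A) xs × t ∈ ⟦ ♡ ⟧ (λ _ → _∈ˡ xs))}
      ... | yes (xs , len , xs∈ , t∈xs) =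
        (_∈ˡ xs) , All.lookup xs∈ , (xs , len , id , id) , t∈xs
      ... | no none = ⊥-elim (¬failure (addPoint t t∈ λ xs len xs∈ t∈xs →
        none (xs , len , xs∈ , t∈xs)))

  -- Separating models built from failures of boundedness.

  separateByPredicate : ∀ {n k} (P : Σ (suc n)) →
    BoundFailure S ♡ k → Separates S ♡ (⊤ᵘ S) (diagonal S P) k
  separateByPredicate {Σ = Σ} P F = record
    { model       = record { C = C ; γ = const t ; I = I }
    ; point       = proj₁ outside
    ; guarded     = id
    ; supported   = supported
    ; unsupported = λ _ → unsupported
    }
    where
    open BoundFailure F
    I : ∀ {m} → Σ m → Pred (Vec.Vec C m) 0ℓ
    -- Every symbol of positive arity tests its first argument, so the diagonal of `P` defines `A`.
    I _ []      = ⊥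
    I _ (c ∷ _) = A c

  module _ {p : Λ 0} (atom : PropositionalAtom S p) where
    open PropositionalAtom atom

    bit : ∀ {k} → BoundFailure S ♡ k → Bool
    bit F = proj₂ (Inverse.to (split _) (BoundFailure.t F))

    guard : Bool → UnaryFormula S Σ
    guard true  = atomic S p
    guard false = ¬ᵘ_ S (atomic S p)

    separateByAtom : ∀ {k} (F : BoundFailure S ♡ k) →
                     Separates S {Σ = Σ} ♡ (guard (bit F)) (atomic S p) k
    separateByAtom {Σ = Σ} {k} F = record
      { model       = M
      ; point       = proj₁ (agreeing (bit F))
      ; guarded     = proj₂ (agreeing (bit F))
      ; supported   = subst (_∈ ⟦ ♡ ⟧ (λ _ → α.⟪ M ⟫)) (sym (γ≡t (proj₂ (agreeing (bit F)))))
                        (proj₂ (⟦⟧-cong ♡ λ _ → p≐A) supported)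
      ; unsupported = λ gc xs len xs∈ →
          subst (_∉ ⟦ ♡ ⟧ (λ _ → _∈ˡ xs)) (sym (γ≡t gc))
            (unsupported xs len (All.map (proj₁ p≐A) xs∈))
      }
      where
      open BoundFailure F
      module α = UnaryFormula (atomic S {Σ = Σ} p)
      t′ = proj₁ (Inverse.to (split C) t)

      isIn : C → Bool
      isIn c = does (em {P = c ∈ A})

      M : Model S Σ
      M = record
        { C = C
        -- The `T'` component of `t` is kept and its bit replaced by membership in `A`, so that the
        -- atom defines `A`.
        ; γ = λ c → Inverse.from (split C) (t′ , isIn c)
        ; I = λ _ _ → ⊥
        }

      atom-of-γ : ∀ c → proj₂ (Inverse.to (split C) (Model.γ M c)) ≡ isIn c
      atom-of-γ c = cong proj₂ (Inverse.strictlyInverseˡ (split C) (t′ , isIn c))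

      p⇒isIn : ∀ {c} → c ∈ α.⟪ M ⟫ → isIn c ≡ true
      p⇒isIn {c} c∈ = trans (sym (atom-of-γ c)) (proj₁ (⟦p⟧ C _) c∈)

      isIn⇒p : ∀ {c} → isIn c ≡ true → c ∈ α.⟪ M ⟫
      isIn⇒p {c} eq = proj₂ (⟦p⟧ C _) (trans (atom-of-γ c) eq)

      p≐A : α.⟪ M ⟫ ≐ A
      p≐A = (λ c∈ → does-true em (p⇒isIn c∈)) , λ c∈ → isIn⇒p (dec-true em c∈)
        where
        does-true : ∀ {P : Set} (P? : Dec P) → does P? ≡ true → P
        does-true (yes p) _ = p

      -- Both `A` and its complement are inhabited, so either guard selects some point.
      agreeing : ∀ b → ∃[ c ] c ∈ UnaryFormula.⟪_⟫ (guard b) M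
      agreeing true  = let c , c∈ = inside F in c , proj₂ p≐A c∈
      agreeing false = let c , c∉ = outside  in c , c∉ ∘ proj₁ p≐A

      guard⇒isIn : ∀ b {c} → c ∈ UnaryFormula.⟪_⟫ (guard b) M → isIn c ≡ b
      guard⇒isIn true  c∈ = p⇒isIn c∈
      guard⇒isIn false c∉ = dec-false em (c∉ ∘ proj₂ p≐A)

      -- At a guarded point the bit is that of `t`, so `from` is applied to the splitting of `t`
      -- itself.
      γ≡t : ∀ {c} → c ∈ UnaryFormula.⟪_⟫ (guard (bit F)) M → Model.γ M c ≡ t
      γ≡t gc = trans (cong (λ b → Inverse.from (split C) (t′ , b)) (guard⇒isIn (bit F) gc))
                     (Inverse.strictlyInverseʳ (split C) t)

-- The bit of a failure may vary with k, whereas the set of sentences needs one guard for all k. If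
-- `true` fails at j and `false` at k, then by antitonicity both fail at `j ⊔ k`.
pigeonhole : ∀ {P : ℕ → Bool → Set₁} → (∀ {j k b} → j ≤ k → P k b → P j b) →
  (∀ k → ¬ ¬ (∃[ b ] P k b)) → ¬ (∀ b → ¬ (∀ k → ¬ ¬ P k b))
pigeonhole antitone some none =
  none true λ j ¬Pj → none false λ k ¬Pk → some (j ⊔ k) λ
    { (true  , Pjk) → ¬Pj (antitone (m≤m⊔n j k) Pjk)
    ; (false , Pjk) → ¬Pk (antitone (m≤n⊔m j k) Pjk)
    }

theorem3p37 : ExcludedMiddle 0ℓ →
    ∀ {Λ Σ : ℕ → Set} (S : Structure Λ) (♡ : Λ 1) →
    ωBounded S ♡ →
    (∀ k → ¬ Bounded S k ♡) →
    (∃[ n ] Σ (suc n)) ⊎ (∃[ p ] PropositionalAtom S p) →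
    ∀ (R : Pred (Rule Λ) 0ℓ) → (∀ {r} → r ∈ R → OneStepSound S r) →
    ∀ (♭ : BoundednessSignature Λ) →
    ¬ StronglyComplete S Σ R ♭
theorem3p37 em {Σ = Σ} S ♡ ω-bounded unbounded (inj₁ (n , P)) R _ ♭ =
  Incompactness.incompact em S ♡ ω-bounded (⊤ᵘ S) (diagonal S {Σ = Σ} P) λ k ¬sep →
    boundFailure em S ♡ ω-bounded k (unbounded k) (¬sep ∘ separateByPredicate em S ♡ P)
theorem3p37 em S ♡ ω-bounded unbounded (inj₂ (p , atom)) R _ ♭ complete =
  pigeonhole {P = λ k b → Separates S ♡ (guard em S ♡ atom b) (atomic S p) k}
    (λ j≤k sep → let open Separates sep in record
      { model       = model
      ; point       = point
      ; guarded     = guarded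
      ; supported   = supported
      ; unsupported = λ gc xs len → unsupported gc xs (≤-trans len j≤k)
      })
    (λ k ¬sep → boundFailure em S ♡ ω-bounded k (unbounded k) λ F →
       ¬sep (bit em S ♡ atom F , separateByAtom em S ♡ atom F))
    (λ b separates → Incompactness.incompact em S ♡ ω-bounded _ _ separates complete)
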